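{- Let $k,r,n\in\mathbb{N}$ with $0<k<\frac n2$ be such that $\gcd(k,n)=1$ and $k^r\equiv 1 \pmod n$. Then the generalized Petersen graph $G(n,k)$ is an induced subgraph of a minimal Cayley graph of the semidirect product $$C_n\rtimes C_r=\langle a,b\mid a^r=b^n=e,\ aba^{ -1}=b^k\rangle .$$
   Context: For integers $k,n$ with $0<k<\frac n2$, the generalized Petersen graph $G(n,k)$ is the graph on the $2n$ vertices $u_0,\dots,u_{n-1},v_0,\dots,v_{n-1}$ with edges $u_iu_{i+1}$, $v_iv_{i+k}$ and $u_iv_i$ for $0\le i\le n-1$, all subscripts taken modulo $n$. For a finite group $\Gamma$ and a subset $S\subseteq\Gamma$, the (undirected, right) Cayley graph $\mathrm{Cay}(\Gamma,S)$ has vertex set $\Gamma$, and $g,h\in\Gamma$ form an edge if $g^{ -1}h\in S$ or $h^{ -1}g\in S$ (the graph is regarded as undirected even if $S$ is not inverse-closed). It is called minimal if $S$ is an inclusion-minimal generating set of $\Gamma$, i.e. $S$ generates $\Gamma$ and no proper subset of $S$ does. "Is an induced subgraph of" means "is isomorphic to an induced subgraph of". $C_m$ denotes the cyclic group of order $m$. The semidirect product $C_n\rtimes C_r$ is the one in which a generator $a$ of $C_r$ acts on $C_n=\langle b\rangle$ by $b\mapsto b^k$.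
   Formalization: The formal theorem additionally assumes r > 1; for r = 1 the hypotheses force k = 1 and the group is C_n with only n elements, which cannot contain the 2n-vertex graph G(n,1), so the printed claim fails there. -}

module Defs where

open import Algebra.Bundles using (Group)
open import Data.Fin.Base using (Fin; toℕ)
open import Data.Fin.Properties using (toℕ-fromℕ<; toℕ-injective; toℕ<n; toℕ≤n)
open import Data.Nat.Base using (ℕ; zero; suc; _+_; _*_; _∸_; _^_; NonZero)
open import Data.Nat.DivMod
  using (_/_; _%_; _mod_; m%n<n; m%n%n≡m%n; m<n⇒m%n≡m; n%n≡0; m≡m%n+[m/n]*n;
         %-distribˡ-+; %-distribˡ-*)
open import Data.Nat.Properties
  using (+-assoc; +-comm; *-assoc; *-comm; *-distribˡ-+; *-identityˡ; *-identityʳ;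
         m∸n+n≡m; ^-distribˡ-+-*; ^-*-assoc)
open import Data.Product.Base using (Σ; Σ-syntax; _×_; _,_; proj₁; proj₂)
open import Data.Product.Relation.Binary.Pointwise.NonDependent using (Pointwise; ×-isEquivalence)
open import Function.Base using (_on_)
open import Function.Bundles using (Inverse; _⇔_)
open import Level using (Level; _⊔_; 0ℓ) renaming (suc to lsuc)
open import Relation.Binary.Bundles using (Setoid)
open import Relation.Binary.Construct.Closure.Symmetric using (SymClosure; fwd; bwd; symmetric)
import Relation.Binary.Construct.On as On
open import Relation.Binary.Core using (Rel)
open import Relation.Binary.Definitions using (Symmetric; _Respects₂_; _Respects_)
open import Relation.Binary.PropositionalEquality
  using (_≡_; refl; sym; trans; cong; cong₂; setoid; isEquivalence; resp₂; module ≡-Reasoning)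
open import Relation.Nullary.Negation using (¬_)
open import Relation.Unary using (Pred; _∈_; _⊂_)

-- Undirected graphs on a setoid of vertices.  Loops are not excluded:
-- Cay(Γ, S) has them exactly when S contains the identity, which never
-- happens for an inclusion-minimal generating set.

record Graph (v ℓ e : Level) : Set (lsuc (v ⊔ ℓ ⊔ e)) where
  field
    vertices : Setoid v ℓ
  open Setoid vertices public using (_≈_) renaming (Carrier to Vertex)
  field
    _~_    : Rel Vertex e
    ~-sym  : Symmetric _~_
    ~-resp : _~_ Respects₂ _≈_

induced : ∀ {v ℓ e p} (G : Graph v ℓ e) → Pred (Graph.Vertex G) p → Graph (v ⊔ p) ℓ e
induced G P = record
  { vertices = On.setoid {B = Σ[ x ∈ Vertex ] P x} vertices proj₁
  ; _~_      = _~_ on proj₁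
  ; ~-sym    = ~-sym
  ; ~-resp   = proj₁ ~-resp , proj₂ ~-resp
  }
  where open Graph G

record _≅_ {v ℓ e v′ ℓ′ e′} (G : Graph v ℓ e) (H : Graph v′ ℓ′ e′)
       : Set (v ⊔ ℓ ⊔ e ⊔ v′ ⊔ ℓ′ ⊔ e′) where
  private
    module G = Graph G
    module H = Graph H
  field
    bijection : Inverse G.vertices H.vertices
  open Inverse bijection public using (to; from)
  field
    adjacency : ∀ x y → (x G.~ y) ⇔ (to x H.~ to y)

_IsInducedSubgraphOf_ : ∀ {v ℓ e v′ ℓ′ e′} → Graph v ℓ e → Graph v′ ℓ′ e′ →
                        Set (v ⊔ ℓ ⊔ e ⊔ lsuc v′ ⊔ ℓ′ ⊔ e′)
_IsInducedSubgraphOf_ {v′ = v′} G H = Σ[ P ∈ Pred (Graph.Vertex H) v′ ] (G ≅ induced H P)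

data PetersenVertex (n : ℕ) : Set where
  u v : Fin n → PetersenVertex n

data PetersenEdge (n k : ℕ) .{{_ : NonZero n}} : Rel (PetersenVertex n) 0ℓ where
  outer : ∀ i → PetersenEdge n k (u i) (u ((toℕ i + 1) mod n))
  inner : ∀ i → PetersenEdge n k (v i) (v ((toℕ i + k) mod n))
  spoke : ∀ i → PetersenEdge n k (u i) (v i)

-- G(n, k); the standing assumption 0 < k < n / 2 is left to its users.
petersen : (n k : ℕ) .{{_ : NonZero n}} → Graph 0ℓ 0ℓ 0ℓ
petersen n k = record
  { vertices = setoid (PetersenVertex n)
  ; _~_      = SymClosure (PetersenEdge n k)
  ; ~-sym    = symmetric (PetersenEdge n k)
  ; ~-resp   = resp₂ (SymClosure (PetersenEdge n k))
  }

module _ {c ℓ} (Γ : Group c ℓ) where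
  open Group Γ using (Carrier; _≈_; _∙_; ε; _⁻¹; ∙-cong; ⁻¹-cong)

  data ⟨_⟩ {p} (S : Pred Carrier p) : Pred Carrier (c ⊔ ℓ ⊔ p) where
    gen    : ∀ {x} → x ∈ S → ⟨ S ⟩ x
    unit   : ⟨ S ⟩ ε
    mul    : ∀ {x y} → ⟨ S ⟩ x → ⟨ S ⟩ y → ⟨ S ⟩ (x ∙ y)
    inv    : ∀ {x} → ⟨ S ⟩ x → ⟨ S ⟩ (x ⁻¹)
    resp-≈ : ∀ {x y} → x ≈ y → ⟨ S ⟩ x → ⟨ S ⟩ y

  Generates : ∀ {p} → Pred Carrier p → Set (c ⊔ ℓ ⊔ p)
  Generates S = ∀ g → ⟨ S ⟩ g

  -- Subsets of the group are the predicates respecting _≈_.  Without that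
  -- requirement T could drop one of two equal elements of S and still generate.
  MinimallyGenerates : ∀ {p} → Pred Carrier p → Set (c ⊔ ℓ ⊔ lsuc p)
  MinimallyGenerates {p} S =
    Generates S ×
    (∀ (T : Pred Carrier p) → T Respects _≈_ → T ⊂ S → ¬ Generates T)

  Cay : ∀ {p} (S : Pred Carrier p) → S Respects _≈_ → Graph c ℓ p
  Cay {p} S S-resp = record
    { vertices = Group.setoid Γ
    ; _~_      = SymClosure E
    ; ~-sym    = symmetric E
    ; ~-resp   = (λ { y≈z (fwd p) → fwd (Eʳ y≈z p) ; y≈z (bwd p) → bwd (Eˡ y≈z p) })
               , (λ { y≈z (fwd p) → fwd (Eˡ y≈z p) ; y≈z (bwd p) → bwd (Eʳ y≈z p) })
    }
    where
    E : Rel Carrier p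
    E g h = (g ⁻¹ ∙ h) ∈ S

    Eˡ : ∀ {g g′ h} → g ≈ g′ → E g h → E g′ h
    Eˡ g≈g′ = S-resp (∙-cong (⁻¹-cong g≈g′) (Group.refl Γ))

    Eʳ : ∀ {g h h′} → h ≈ h′ → E g h → E g h′
    Eʳ h≈h′ = S-resp (∙-cong (Group.refl Γ) h≈h′)

  MinimalCayleyGraph : ∀ p → Set (c ⊔ ℓ ⊔ lsuc p)
  MinimalCayleyGraph p =
    Σ[ S ∈ Pred Carrier p ] (S Respects _≈_ × MinimallyGenerates S)

  cayleyGraph : ∀ {p} → MinimalCayleyGraph p → Graph c ℓ p
  cayleyGraph (S , S-resp , _) = Cay S S-resp

-- A homomorphism from H to the automorphism group of N; each φ h is
-- invertible because φ (h ⁻¹) is its inverse.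
record ActionByAutomorphisms {c ℓ c′ ℓ′} (N : Group c ℓ) (H : Group c′ ℓ′)
       : Set (c ⊔ ℓ ⊔ c′ ⊔ ℓ′) where
  private
    module N = Group N
    module H = Group H
  field
    φ      : H.Carrier → N.Carrier → N.Carrier
    φ-cong : ∀ {g h x y} → g H.≈ h → x N.≈ y → φ g x N.≈ φ h y
    φ-homo : ∀ h x y → φ h (x N.∙ y) N.≈ φ h x N.∙ φ h y
    φ-ε    : ∀ x → φ H.ε x N.≈ x
    φ-∙    : ∀ g h x → φ (g H.∙ h) x N.≈ φ g (φ h x)

module _ {c ℓ c′ ℓ′} (N : Group c ℓ) (H : Group c′ ℓ′) (A : ActionByAutomorphisms N H) where
  private
    module N = Group N
    module H = Group H
  open ActionByAutomorphisms A
  open import Relation.Binary.Reasoning.Setoid N.setoid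
  open import Algebra.Properties.Group N using (identityʳ-unique)

  private
    φ-unit : ∀ h → φ h N.ε N.≈ N.ε
    φ-unit h = identityʳ-unique _ _ (N.trans (N.sym (φ-homo h N.ε N.ε))
                                             (φ-cong H.refl (N.identityˡ N.ε)))

  -- The pair (x , h) stands for the product x h, so that h x h⁻¹ = φ h x.
  semidirect : Group (c ⊔ c′) (ℓ ⊔ ℓ′)
  semidirect = record
    { Carrier = N.Carrier × H.Carrier
    ; _≈_     = Pointwise N._≈_ H._≈_
    ; _∙_     = λ { (x , g) (y , h) → x N.∙ φ g y , g H.∙ h }
    ; ε       = N.ε , H.ε
    ; _⁻¹     = λ { (x , g) → φ (g H.⁻¹) (x N.⁻¹) , g H.⁻¹ }
    ; isGroup = record
      { isMonoid = record
        { isSemigroup = record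
          { isMagma = record
            { isEquivalence = ×-isEquivalence N.isEquivalence H.isEquivalence
            ; ∙-cong = λ { (p , q) (p′ , q′) → N.∙-cong p (φ-cong q p′) , H.∙-cong q q′ }
            }
          ; assoc = λ { (x , f) (y , g) (z , h) → assoc′ x y z f g , H.assoc f g h }
          }
        ; identity = (λ { (x , g) → N.trans (N.identityˡ _) (φ-ε x) , H.identityˡ g })
                   , (λ { (x , g) → N.trans (N.∙-congˡ (φ-unit g)) (N.identityʳ x) , H.identityʳ g })
        }
      ; inverse = (λ { (x , g) → inverseˡ′ x g , H.inverseˡ g })
                , (λ { (x , g) → inverseʳ′ x g , H.inverseʳ g })
      ; ⁻¹-cong = λ { (p , q) → φ-cong (H.⁻¹-cong q) (N.⁻¹-cong p) , H.⁻¹-cong q }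
      }
    }
    where
    assoc′ : ∀ x y z f g →
             (x N.∙ φ f y) N.∙ φ (f H.∙ g) z N.≈ x N.∙ φ f (y N.∙ φ g z)
    assoc′ x y z f g = begin
      (x N.∙ φ f y) N.∙ φ (f H.∙ g) z   ≈⟨ N.assoc _ _ _ ⟩
      x N.∙ (φ f y N.∙ φ (f H.∙ g) z)   ≈⟨ N.∙-congˡ (N.∙-congˡ (φ-∙ f g z)) ⟩
      x N.∙ (φ f y N.∙ φ f (φ g z))     ≈⟨ N.∙-congˡ (φ-homo f y (φ g z)) ⟨
      x N.∙ φ f (y N.∙ φ g z)           ∎

    inverseˡ′ : ∀ x g → φ (g H.⁻¹) (x N.⁻¹) N.∙ φ (g H.⁻¹) x N.≈ N.ε
    inverseˡ′ x g = begin
      φ (g H.⁻¹) (x N.⁻¹) N.∙ φ (g H.⁻¹) x   ≈⟨ φ-homo _ _ _ ⟨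
      φ (g H.⁻¹) (x N.⁻¹ N.∙ x)              ≈⟨ φ-cong H.refl (N.inverseˡ x) ⟩
      φ (g H.⁻¹) N.ε                         ≈⟨ φ-unit _ ⟩
      N.ε                                    ∎

    inverseʳ′ : ∀ x g → x N.∙ φ g (φ (g H.⁻¹) (x N.⁻¹)) N.≈ N.ε
    inverseʳ′ x g = begin
      x N.∙ φ g (φ (g H.⁻¹) (x N.⁻¹))   ≈⟨ N.∙-congˡ (φ-∙ g (g H.⁻¹) (x N.⁻¹)) ⟨
      x N.∙ φ (g H.∙ g H.⁻¹) (x N.⁻¹)   ≈⟨ N.∙-congˡ (φ-cong (H.inverseʳ g) N.refl) ⟩
      x N.∙ φ H.ε (x N.⁻¹)              ≈⟨ N.∙-congˡ (φ-ε _) ⟩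
      x N.∙ x N.⁻¹                      ≈⟨ N.inverseʳ x ⟩
      N.ε                               ∎

module _ (n : ℕ) .{{_ : NonZero n}} where
  open ≡-Reasoning

  toℕ-mod : ∀ a → toℕ (a mod n) ≡ a % n
  toℕ-mod a = toℕ-fromℕ< (m%n<n a n)

  mod-cong : ∀ {a b} → a % n ≡ b % n → a mod n ≡ b mod n
  mod-cong {a} {b} eq = toℕ-injective (trans (toℕ-mod a) (trans eq (sym (toℕ-mod b))))

  mod-toℕ : ∀ (i : Fin n) → toℕ i mod n ≡ i
  mod-toℕ i = toℕ-injective (trans (toℕ-mod (toℕ i)) (m<n⇒m%n≡m (toℕ<n i)))

  toℕ-mod-% : ∀ a → toℕ (a mod n) % n ≡ a % n
  toℕ-mod-% a = trans (cong (_% n) (toℕ-mod a)) (m%n%n≡m%n a n)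

  +-cong-% : ∀ {a a′ b b′} → a % n ≡ a′ % n → b % n ≡ b′ % n → (a + b) % n ≡ (a′ + b′) % n
  +-cong-% {a} {a′} {b} {b′} p q = begin
    (a + b) % n               ≡⟨ %-distribˡ-+ a b n ⟩
    (a % n + b % n) % n       ≡⟨ cong₂ (λ x y → (x + y) % n) p q ⟩
    (a′ % n + b′ % n) % n     ≡⟨ %-distribˡ-+ a′ b′ n ⟨
    (a′ + b′) % n             ∎

  *-cong-% : ∀ {a a′ b b′} → a % n ≡ a′ % n → b % n ≡ b′ % n → (a * b) % n ≡ (a′ * b′) % n
  *-cong-% {a} {a′} {b} {b′} p q = begin
    (a * b) % n               ≡⟨ %-distribˡ-* a b n ⟩
    ((a % n) * (b % n)) % n   ≡⟨ cong₂ (λ x y → (x * y) % n) p q ⟩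
    ((a′ % n) * (b′ % n)) % n ≡⟨ %-distribˡ-* a′ b′ n ⟨
    (a′ * b′) % n             ∎

  ^-one-% : ∀ {a} q → a % n ≡ 1 % n → (a ^ q) % n ≡ 1 % n
  ^-one-% zero    p = refl
  ^-one-% {a} (suc q) p = *-cong-% {a} {1} p (^-one-% q p)

  ^-exponent-% : ∀ k r .{{_ : NonZero r}} → (k ^ r) % n ≡ 1 % n →
                 ∀ x → (k ^ (x % r)) % n ≡ (k ^ x) % n
  ^-exponent-% k r p x = sym (begin
    (k ^ x) % n
      ≡⟨ cong (λ y → (k ^ y) % n) (m≡m%n+[m/n]*n x r) ⟩
    (k ^ (x % r + (x / r) * r)) % n
      ≡⟨ cong (_% n) (^-distribˡ-+-* k (x % r) ((x / r) * r)) ⟩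
    (k ^ (x % r) * k ^ ((x / r) * r)) % n
      ≡⟨ *-cong-% {k ^ (x % r)} refl k^qr≡1 ⟩
    (k ^ (x % r) * 1) % n
      ≡⟨ cong (_% n) (*-identityʳ _) ⟩
    (k ^ (x % r)) % n ∎)
    where
    k^qr≡1 : (k ^ ((x / r) * r)) % n ≡ 1 % n
    k^qr≡1 = begin
      (k ^ ((x / r) * r)) % n   ≡⟨ cong (λ y → (k ^ y) % n) (*-comm (x / r) r) ⟩
      (k ^ (r * (x / r))) % n   ≡⟨ cong (_% n) (^-*-assoc k r (x / r)) ⟨
      ((k ^ r) ^ (x / r)) % n   ≡⟨ ^-one-% (x / r) p ⟩
      1 % n                     ∎

-- ℤ/m, written additively on residues; the generator is 1 mod m.
C : (m : ℕ) .{{_ : NonZero m}} → Group 0ℓ 0ℓ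
C m = record
  { Carrier = Fin m
  ; _≈_     = _≡_
  ; _∙_     = _⊕_
  ; ε       = 0 mod m
  ; _⁻¹     = ⊖_
  ; isGroup = record
    { isMonoid = record
      { isSemigroup = record
        { isMagma = record { isEquivalence = isEquivalence ; ∙-cong = cong₂ _⊕_ }
        ; assoc   = assoc
        }
      ; identity = identityˡ , λ i → trans (comm i _) (identityˡ i)
      }
    ; inverse = inverseˡ , λ i → trans (comm i _) (inverseˡ i)
    ; ⁻¹-cong = cong ⊖_
    }
  }
  where
  infixl 6 _⊕_
  _⊕_ : Fin m → Fin m → Fin m
  i ⊕ j = (toℕ i + toℕ j) mod m

  ⊖_ : Fin m → Fin m
  ⊖ i = (m ∸ toℕ i) mod m

  comm : ∀ i j → i ⊕ j ≡ j ⊕ i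
  comm i j = cong (_mod m) (+-comm (toℕ i) (toℕ j))

  assoc : ∀ i j l → (i ⊕ j) ⊕ l ≡ i ⊕ (j ⊕ l)
  assoc i j l = mod-cong m (trans
    (+-cong-% m (toℕ-mod-% m (toℕ i + toℕ j)) refl)
    (trans (cong (_% m) (+-assoc (toℕ i) (toℕ j) (toℕ l)))
           (sym (+-cong-% m {toℕ i} refl (toℕ-mod-% m (toℕ j + toℕ l))))))

  identityˡ : ∀ i → (0 mod m) ⊕ i ≡ i
  identityˡ i = trans (mod-cong m (+-cong-% m {b = toℕ i} (toℕ-mod-% m 0) refl)) (mod-toℕ m i)

  inverseˡ : ∀ i → (⊖ i) ⊕ i ≡ 0 mod m
  inverseˡ i = mod-cong m (trans
    (+-cong-% m {b = toℕ i} (toℕ-mod-% m (m ∸ toℕ i)) refl)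
    (trans (cong (_% m) (m∸n+n≡m (toℕ≤n i))) (trans (n%n≡0 m) (sym (m<n⇒m%n≡m m>0)))))
    where
    open import Data.Nat.Base using (>-nonZero⁻¹; _<_)
    m>0 : 0 < m
    m>0 = >-nonZero⁻¹ m

-- The generator a of C_r acts by b ↦ b^k, hence aˣ acts by bʲ ↦ b^(kˣ j);
-- that this is well defined on residues x mod r is where k^r ≡ 1 is needed.
powerAction : (n k r : ℕ) .{{_ : NonZero n}} .{{_ : NonZero r}} →
              (k ^ r) % n ≡ 1 % n → ActionByAutomorphisms (C n) (C r)
powerAction n k r k^r≡1 = record
  { φ      = φ
  ; φ-cong = cong₂ φ
  ; φ-homo = φ-homo
  ; φ-ε    = φ-ε
  ; φ-∙    = φ-∙
  }
  where
  open ≡-Reasoning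

  φ : Fin r → Fin n → Fin n
  φ x j = (k ^ toℕ x * toℕ j) mod n

  exponent : ∀ x → (k ^ toℕ (x mod r)) % n ≡ (k ^ x) % n
  exponent x = trans (cong (λ y → (k ^ y) % n) (toℕ-mod r x)) (^-exponent-% n k r k^r≡1 x)

  φ-homo : ∀ x i j → φ x ((toℕ i + toℕ j) mod n) ≡ (toℕ (φ x i) + toℕ (φ x j)) mod n
  φ-homo x i j = mod-cong n (begin
    (K * toℕ ((toℕ i + toℕ j) mod n)) % n   ≡⟨ *-cong-% n {K} refl (toℕ-mod-% n (toℕ i + toℕ j)) ⟩
    (K * (toℕ i + toℕ j)) % n               ≡⟨ cong (_% n) (*-distribˡ-+ K (toℕ i) (toℕ j)) ⟩
    (K * toℕ i + K * toℕ j) % n             ≡⟨ +-cong-% n (toℕ-mod-% n (K * toℕ i)) (toℕ-mod-% n (K * toℕ j)) ⟨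
    (toℕ (φ x i) + toℕ (φ x j)) % n         ∎)
    where
    K : ℕ
    K = k ^ toℕ x

  φ-ε : ∀ j → φ (0 mod r) j ≡ j
  φ-ε j = trans (mod-cong n (trans (*-cong-% n {b = toℕ j} (exponent 0) refl)
                                   (cong (_% n) (*-identityˡ (toℕ j)))))
                (mod-toℕ n j)

  φ-∙ : ∀ x y j → φ ((toℕ x + toℕ y) mod r) j ≡ φ x (φ y j)
  φ-∙ x y j = mod-cong n (begin
    (k ^ toℕ ((toℕ x + toℕ y) mod r) * toℕ j) % n
      ≡⟨ *-cong-% n {b = toℕ j} (exponent (toℕ x + toℕ y)) refl ⟩
    (k ^ (toℕ x + toℕ y) * toℕ j) % n
      ≡⟨ cong (λ z → (z * toℕ j) % n) (^-distribˡ-+-* k (toℕ x) (toℕ y)) ⟩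
    (k ^ toℕ x * k ^ toℕ y * toℕ j) % n
      ≡⟨ cong (_% n) (*-assoc (k ^ toℕ x) (k ^ toℕ y) (toℕ j)) ⟩
    (k ^ toℕ x * (k ^ toℕ y * toℕ j)) % n
      ≡⟨ *-cong-% n {k ^ toℕ x} refl (toℕ-mod-% n (k ^ toℕ y * toℕ j)) ⟨
    (k ^ toℕ x * toℕ (φ y j)) % n ∎)

cyclicSemidirect : (n k r : ℕ) .{{_ : NonZero n}} .{{_ : NonZero r}} →
                   (k ^ r) % n ≡ 1 % n → Group 0ℓ 0ℓ
cyclicSemidirect n k r k^r≡1 = semidirect (C n) (C r) (powerAction n k r k^r≡1)

{-# OPTIONS --safe #-}
module Submission where

-- Take S = {a, b} with the generators a and b.  Since bⁱaʰ·b = b^(i + kʰ) aʰ and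
-- bⁱaʰ·a = bⁱaʰ⁺¹, the elements bⁱ form the outer rim, the elements bⁱa the
-- inner rim, and right multiplication by a gives the spokes.

open import Defs
open import Algebra.Bundles using (Group)
open import Data.Fin.Base using (toℕ)
open import Data.Nat.Base using (ℕ; zero; suc; _+_; _*_; _^_; _<_; NonZero)
open import Data.Nat.DivMod using (_%_; _mod_; m<n⇒m%n≡m)
open import Data.Nat.GCD using (gcd)
open import Data.Nat.Properties using (*-identityʳ; ≤-trans; ≤-<-trans; <-trans; n<1+n; m≤m+n)
open import Data.Product.Base using (Σ-syntax; _,_; proj₁; proj₂)
open import Data.Sum.Base using (_⊎_; inj₁; inj₂)
open import Function.Base using (_∘_)
open import Function.Bundles using (mk⇔)
open import Level using (0ℓ)
open import Relation.Binary.Construct.Closure.Symmetric using (SymClosure; fwd; bwd; gmap; symmetric)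
open import Relation.Binary.Definitions using (_Respects_)
open import Relation.Binary.PropositionalEquality
  using (_≡_; _≢_; refl; sym; trans; cong; cong₂; module ≡-Reasoning)
open import Relation.Nullary.Negation using (¬_; contradiction)
open import Relation.Unary using (Pred; _∈_; _⊆_)

module _ {c ℓ} (Γ : Group c ℓ) where
  open Group Γ using (Carrier; _≈_; _∙_; ε; _⁻¹; ∙-congˡ) renaming (trans to ≈-trans; sym to ≈-sym)
  open import Algebra.Properties.Group Γ using (\\-leftDividesˡ; \\-leftDividesʳ)

  -- Induction on the derivation of membership. It serves to show that a set does not generate: it
  -- is enough to trap the set in a proper subgroup `Q`.
  ⟨⟩-least : ∀ {p q} {S : Pred Carrier p} {Q : Pred Carrier q} →
             Q Respects _≈_ → Q ε → (∀ {x y} → Q x → Q y → Q (x ∙ y)) → (∀ {x} → Q x → Q (x ⁻¹)) →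
             S ⊆ Q → ⟨_⟩ Γ S ⊆ Q
  ⟨⟩-least {S = S} {Q} Q-resp Q-ε Q-∙ Q-⁻¹ S⊆Q = go
    where
    go : ⟨_⟩ Γ S ⊆ Q
    go (gen x∈S)        = S⊆Q x∈S
    go unit             = Q-ε
    go (mul p q)        = Q-∙ (go p) (go q)
    go (inv p)          = Q-⁻¹ (go p)
    go (resp-≈ x≈y p)   = Q-resp x≈y (go p)

  -- Adjacency in a Cayley graph is phrased through `g ⁻¹ ∙ h`. This lemma and its converse below
  -- trade it for right multiplication by a generator, which can be computed in coordinates.
  left-quotient : ∀ {g h s} → g ⁻¹ ∙ h ≈ s → h ≈ g ∙ s
  left-quotient {g} {h} eq = ≈-trans (≈-sym (\\-leftDividesˡ g h)) (∙-congˡ eq)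

  left-quotient⁻¹ : ∀ {g h s} → h ≈ g ∙ s → g ⁻¹ ∙ h ≈ s
  left-quotient⁻¹ {g} {s = s} eq = ≈-trans (∙-congˡ eq) (\\-leftDividesʳ g s)

module _ {c ℓ c′ ℓ′} (N : Group c ℓ) (H : Group c′ ℓ′) (A : ActionByAutomorphisms N H) where
  private
    module N = Group N
    module H = Group H
    G = semidirect N H A
  open ActionByAutomorphisms A
  open import Algebra.Properties.Group N using (identityʳ-unique) renaming (ε⁻¹≈ε to N-ε⁻¹)
  open import Algebra.Properties.Group H using () renaming (ε⁻¹≈ε to H-ε⁻¹)

  φ-unit : ∀ h → φ h N.ε N.≈ N.ε
  φ-unit h = identityʳ-unique _ _ (N.trans (N.sym (φ-homo h N.ε N.ε))
                                           (φ-cong H.refl (N.identityˡ N.ε)))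

  -- The elements with trivial first coordinate form the complement `H`; they are closed under the
  -- operations because every `φ h` fixes the identity of `N`.
  ⟨⟩-in-complement : ∀ {p} {S : Pred (Group.Carrier G) p} →
                     (∀ {g} → g ∈ S → proj₁ g N.≈ N.ε) → ∀ {g} → ⟨_⟩ G S g → proj₁ g N.≈ N.ε
  ⟨⟩-in-complement {S = S} = ⟨⟩-least G {S = S} {Q = λ g → proj₁ g N.≈ N.ε}
    (λ (x≈y , _) x≈ε → N.trans (N.sym x≈y) x≈ε)
    N.refl
    (λ x≈ε y≈ε → N.trans (N.∙-cong x≈ε (N.trans (φ-cong H.refl y≈ε) (φ-unit _))) (N.identityˡ _))
    (λ x≈ε → N.trans (φ-cong H.refl (N.trans (N.⁻¹-cong x≈ε) N-ε⁻¹)) (φ-unit _))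

  -- The second coordinate is a homomorphism to `H`, and its kernel is the copy of `N`.
  ⟨⟩-in-normal : ∀ {p} {S : Pred (Group.Carrier G) p} →
                 (∀ {g} → g ∈ S → proj₂ g H.≈ H.ε) → ∀ {g} → ⟨_⟩ G S g → proj₂ g H.≈ H.ε
  ⟨⟩-in-normal {S = S} = ⟨⟩-least G {S = S} {Q = λ g → proj₂ g H.≈ H.ε}
    (λ (_ , x≈y) x≈ε → H.trans (H.sym x≈y) x≈ε)
    H.refl
    (λ x≈ε y≈ε → H.trans (H.∙-cong x≈ε y≈ε) (H.identityˡ _))
    (λ x≈ε → H.trans (H.⁻¹-cong x≈ε) H-ε⁻¹)

module _ (m : ℕ) .{{_ : NonZero m}} where

  1mod≢0mod : 1 < m → 1 mod m ≢ 0 mod m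
  1mod≢0mod 1<m eq = contradiction 1≡0 λ ()
    where
    open ≡-Reasoning
    1≡0 : 1 ≡ 0
    1≡0 = begin
      1              ≡⟨ m<n⇒m%n≡m 1<m ⟨
      1 % m          ≡⟨ toℕ-mod m 1 ⟨
      toℕ (1 mod m)  ≡⟨ cong toℕ eq ⟩
      toℕ (0 mod m)  ≡⟨ toℕ-mod m 0 ⟩
      0 % m          ≡⟨ m<n⇒m%n≡m (<-trans (n<1+n 0) 1<m) ⟩
      0              ∎

  mod-+ʳ : ∀ a b → (a + toℕ (b mod m)) mod m ≡ (a + b) mod m
  mod-+ʳ a b = mod-cong m (+-cong-% m {a} refl (toℕ-mod-% m b))

  mod-+ : ∀ a b → (toℕ (a mod m) + toℕ (b mod m)) mod m ≡ (a + b) mod m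
  mod-+ a b = mod-cong m (+-cong-% m (toℕ-mod-% m a) (toℕ-mod-% m b))

module CayleyGraphOnTwoGenerators
  (n k r : ℕ) .{{_ : NonZero n}} .{{_ : NonZero r}}
  (1<n : 1 < n) (1<r : 1 < r) (k^r≡1 : (k ^ r) % n ≡ 1 % n) where

  private
    G = cyclicSemidirect n k r k^r≡1
    module G = Group G
    module N = Group (C n)
    module H = Group (C r)
    A = powerAction n k r k^r≡1
  open ActionByAutomorphisms A using (φ; φ-ε)

  a b : G.Carrier
  a = 0 mod n , 1 mod r
  b = 1 mod n , 0 mod r

  S : Pred G.Carrier 0ℓ
  S g = g G.≈ a ⊎ g G.≈ b

  S-resp : S Respects G._≈_
  S-resp g≈h (inj₁ g≈a) = inj₁ (G.trans (G.sym g≈h) g≈a)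
  S-resp g≈h (inj₂ g≈b) = inj₂ (G.trans (G.sym g≈h) g≈b)

  -- The `C n` part of `a` is trivial and hence fixed by `φ h`, so multiplying by `a` only changes
  -- the coset of ⟨b⟩, whereas multiplying by `b` stays inside it.
  ∙a : ∀ x h → (x , h) G.∙ a G.≈ (x , h H.∙ (1 mod r))
  ∙a x h = trans (cong (x N.∙_) (φ-unit (C n) (C r) A h)) (N.identityʳ x) , refl

  ∙b : ∀ x h → (x , h) G.∙ b G.≈ (x N.∙ φ h (1 mod n) , h)
  ∙b x h = refl , H.identityʳ h

  power-b : ∀ m → ⟨_⟩ G S (m mod n , 0 mod r)
  power-b zero    = unit
  power-b (suc m) = resp-≈
    ( trans (cong ((1 mod n) N.∙_) (φ-ε (m mod n))) (mod-+ n 1 m)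
    , H.identityˡ _)
    (mul (gen (inj₂ G.refl)) (power-b m))

  power-a : ∀ m → ⟨_⟩ G S (0 mod n , m mod r)
  power-a zero    = unit
  power-a (suc m) = resp-≈
    ( trans (N.identityˡ _) (φ-unit (C n) (C r) A (1 mod r))
    , mod-+ r 1 m)
    (mul (gen (inj₁ G.refl)) (power-a m))

  -- Every element has the normal form bˣaʰ.
  generates : Generates G S
  generates (x , h) = resp-≈
    ( trans (cong₂ N._∙_ (mod-toℕ n x) (φ-unit (C n) (C r) A (0 mod r))) (N.identityʳ x)
    , trans (H.identityˡ _) (mod-toℕ r h))
    (mul (power-b (toℕ x)) (power-a (toℕ h)))

  module _ (T : Pred G.Carrier 0ℓ) (T-resp : T Respects G._≈_) (T⊆S : T ⊆ S) (T-gen : Generates G T) where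

    -- Without `a`, the set `T` lies in the normal factor ⟨b⟩, which misses `a`. Membership in an
    -- arbitrary `T` is not decidable, hence the double negation; it suffices because minimality is
    -- itself a negated statement.
    a-needed : ¬ ¬ T a
    a-needed a∉T = 1mod≢0mod r 1<r (⟨⟩-in-normal (C n) (C r) A {S = T} T⊆⟨b⟩ (T-gen a))
      where
      T⊆⟨b⟩ : ∀ {g} → g ∈ T → proj₂ g ≡ 0 mod r
      T⊆⟨b⟩ g∈T with T⊆S g∈T
      ... | inj₁ g≈a       = contradiction (T-resp g≈a g∈T) a∉T
      ... | inj₂ (_ , h≡0) = h≡0

    -- Dually, without `b` the set `T` lies in the complement ⟨a⟩, which misses `b`.
    b-needed : ¬ ¬ T b
    b-needed b∉T = 1mod≢0mod n 1<n (⟨⟩-in-complement (C n) (C r) A {S = T} T⊆⟨a⟩ (T-gen b))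
      where
      T⊆⟨a⟩ : ∀ {g} → g ∈ T → proj₁ g ≡ 0 mod n
      T⊆⟨a⟩ g∈T with T⊆S g∈T
      ... | inj₁ (x≡0 , _) = x≡0
      ... | inj₂ g≈b       = contradiction (T-resp g≈b g∈T) b∉T

  minimallyGenerates : MinimallyGenerates G S
  minimallyGenerates = generates , λ T T-resp (T⊆S , S⊈T) T-gen →
    a-needed T T-resp T⊆S T-gen λ a∈T →
    b-needed T T-resp T⊆S T-gen λ b∈T →
    S⊈T λ { (inj₁ g≈a) → T-resp (G.sym g≈a) a∈T
          ; (inj₂ g≈b) → T-resp (G.sym g≈b) b∈T }

  X : MinimalCayleyGraph G 0ℓ
  X = S , S-resp , minimallyGenerates

  -- The arcs leaving bˣaʰ, in coordinates: the first alternative multiplies by `a`, the second by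
  -- `b`.
  Step : G.Carrier → G.Carrier → Set
  Step (x , h) g = g G.≈ (x , h H.∙ (1 mod r)) ⊎ g G.≈ (x N.∙ φ h (1 mod n) , h)

  step⇒S : ∀ {g h} → Step g h → S (g G.⁻¹ G.∙ h)
  step⇒S {x , h} (inj₁ eq) = inj₁ (left-quotient⁻¹ G (G.trans eq (G.sym (∙a x h))))
  step⇒S {x , h} (inj₂ eq) = inj₂ (left-quotient⁻¹ G (G.trans eq (G.sym (∙b x h))))

  S⇒step : ∀ {g h} → S (g G.⁻¹ G.∙ h) → Step g h
  S⇒step {x , h} (inj₁ eq) = inj₁ (G.trans (left-quotient G eq) (∙a x h))
  S⇒step {x , h} (inj₂ eq) = inj₂ (G.trans (left-quotient G eq) (∙b x h))

  φ-outer : ∀ i → i N.∙ φ (0 mod r) (1 mod n) ≡ (toℕ i + 1) mod n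
  φ-outer i = trans (cong (i N.∙_) (φ-ε (1 mod n))) (mod-+ʳ n (toℕ i) 1)

  φ-inner : ∀ i → i N.∙ φ (1 mod r) (1 mod n) ≡ (toℕ i + k) mod n
  φ-inner i = trans (cong (i N.∙_) (mod-cong n k·1≡k)) (mod-+ʳ n (toℕ i) k)
    where
    open ≡-Reasoning
    k·1≡k : (k ^ toℕ (1 mod r) * toℕ (1 mod n)) % n ≡ k % n
    k·1≡k = begin
      -- Since 1 < r, the residue `1 mod r` is the number 1, so the exponent of k is exactly 1.
      (k ^ toℕ (1 mod r) * toℕ (1 mod n)) % n  ≡⟨ cong (λ e → (k ^ e * toℕ (1 mod n)) % n)
                                                       (trans (toℕ-mod r 1) (m<n⇒m%n≡m 1<r)) ⟩
      (k ^ 1 * toℕ (1 mod n)) % n              ≡⟨ *-cong-% n {k ^ 1} refl (toℕ-mod-% n 1) ⟩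
      (k ^ 1 * 1) % n                          ≡⟨ cong (_% n) (*-identityʳ (k ^ 1)) ⟩
      (k ^ 1) % n                              ≡⟨ cong (_% n) (*-identityʳ k) ⟩
      k % n                                    ∎

  embed : PetersenVertex n → G.Carrier
  embed (u i) = i , 0 mod r
  embed (v i) = i , 1 mod r

  edge⇒step : ∀ {x y} → PetersenEdge n k x y → Step (embed x) (embed y)
  edge⇒step (outer i) = inj₂ (sym (φ-outer i) , refl)
  edge⇒step (inner i) = inj₂ (sym (φ-inner i) , refl)
  edge⇒step (spoke i) = inj₁ (refl , sym (H.identityˡ (1 mod r)))

  private
    1≢0 : 1 mod r ≢ 0 mod r
    1≢0 = 1mod≢0mod r 1<r

    -- Multiplication by `a` never joins two vertices of the same rim.
    h≢h+1 : ∀ {h} → h ≢ h H.∙ (1 mod r)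
    h≢h+1 eq = 1≢0 (identityʳ-unique _ _ (sym eq))
      where open import Algebra.Properties.Group (C r) using (identityʳ-unique)

  -- When r = 2, a is an involution and multiplication by it also leads from vᵢ to uᵢ.
  step⇒edge : ∀ x y → Step (embed x) (embed y) → SymClosure (PetersenEdge n k) x y
  step⇒edge (u i) (u j) (inj₁ (_ , eq))    = contradiction eq h≢h+1
  step⇒edge (u i) (v j) (inj₁ (refl , _))  = fwd (spoke i)
  step⇒edge (v i) (u j) (inj₁ (refl , _))  = bwd (spoke i)
  step⇒edge (v i) (v j) (inj₁ (_ , eq))    = contradiction eq h≢h+1
  step⇒edge (u i) (u j) (inj₂ (eq , _)) rewrite trans eq (φ-outer i) = fwd (outer i)
  step⇒edge (u i) (v j) (inj₂ (_ , 1≡0))   = contradiction 1≡0 1≢0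
  step⇒edge (v i) (u j) (inj₂ (_ , 0≡1))   = contradiction (sym 0≡1) 1≢0
  step⇒edge (v i) (v j) (inj₂ (eq , _)) rewrite trans eq (φ-inner i) = fwd (inner i)

  -- The union of the cosets ⟨b⟩ and ⟨b⟩a, which are distinct because 1 < r.
  OnRim : Pred G.Carrier 0ℓ
  OnRim (_ , h) = h ≡ 0 mod r ⊎ h ≡ 1 mod r

  petersen≅ : petersen n k ≅ induced (cayleyGraph G X) OnRim
  petersen≅ = record
    { bijection = record
      { to        = to
      ; from      = from
      ; to-cong   = λ { refl → G.refl }
      ; from-cong = λ {x} {y} → from-cong x y
      ; inverse   = (λ { {g} refl → to-from g }) , λ {x} {g} → from-to x g
      }
    ; adjacency = λ x y → mk⇔
        (gmap embed (step⇒S ∘ edge⇒step))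
        λ { (fwd s) → step⇒edge x y (S⇒step s)
          ; (bwd s) → symmetric _ (step⇒edge y x (S⇒step s)) }
    }
    where
    embed-onRim : ∀ x → OnRim (embed x)
    embed-onRim (u i) = inj₁ refl
    embed-onRim (v i) = inj₂ refl

    to : PetersenVertex n → Σ[ g ∈ G.Carrier ] OnRim g
    to x = embed x , embed-onRim x

    from : Σ[ g ∈ G.Carrier ] OnRim g → PetersenVertex n
    from ((i , _) , inj₁ _) = u i
    from ((i , _) , inj₂ _) = v i

    to-from : ∀ g → proj₁ (to (from g)) G.≈ proj₁ g
    to-from (_ , inj₁ refl) = G.refl
    to-from (_ , inj₂ refl) = G.refl

    -- Equality in the induced graph ignores the proof of `OnRim`, yet `from` branches on that
    -- proof. The two mixed cases would identify the residues 0 and 1 modulo r.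
    from-cong : ∀ g h → proj₁ g G.≈ proj₁ h → from g ≡ from h
    from-cong (_ , inj₁ _)   (_ , inj₁ _)   (i≡j , _)  = cong u i≡j
    from-cong (_ , inj₂ _)   (_ , inj₂ _)   (i≡j , _)  = cong v i≡j
    from-cong (_ , inj₁ g≡0) (_ , inj₂ h≡1) (_ , g≡h)  = contradiction (trans (sym h≡1) (trans (sym g≡h) g≡0)) 1≢0
    from-cong (_ , inj₂ g≡1) (_ , inj₁ h≡0) (_ , g≡h)  = contradiction (trans (sym g≡1) (trans g≡h h≡0)) 1≢0

    from-to : ∀ x g → proj₁ g G.≈ proj₁ (to x) → from g ≡ x
    from-to (u i) g g≈ = from-cong g (to (u i)) g≈
    from-to (v i) g g≈ = from-cong g (to (v i)) g≈

-- For r = 1 the group would have only n elements, too few for the 2n vertices of G(n, k); hence the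
-- bound 1 < r.
theorem5p1 : (k r n : ℕ) .{{_ : NonZero r}} .{{_ : NonZero n}} →
    0 < k → 2 * k < n → 1 < r →
    gcd k n ≡ 1 → (k^r≡1 : (k ^ r) % n ≡ 1 % n) →
    Σ[ X ∈ MinimalCayleyGraph (cyclicSemidirect n k r k^r≡1) 0ℓ ]
    petersen n k IsInducedSubgraphOf cayleyGraph (cyclicSemidirect n k r k^r≡1) X
theorem5p1 k r n 0<k 2k<n 1<r _ k^r≡1 = X , OnRim , petersen≅
  where
  1<n : 1 < n
  -- As `2 * k` unfolds to `k + (k + 0)`, the chain is 1 ≤ k ≤ 2k < n.
  1<n = ≤-<-trans (≤-trans 0<k (m≤m+n k _)) 2k<n
  open CayleyGraphOnTwoGenerators n k r 1<n 1<r k^r≡1
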